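{- For every pair $(g,r)$ of positive integers, there is a finite poset $P=P(g,r)$ with cover graph $G=G(g,r)$ such that the height of $P$ is $r$, the girth of $G$ is at least $g$, and $\chi(G)=r$. Furthermore, there are two linear extensions $L_1$ and $L_2$ of $P$ witnessing that $\mathrm{eye}(G)\le 2$, i.e., for any three distinct vertices $x,y,z$ of $G$ with $\{y,z\}$ an edge of $G$, there is some $i\in\{1,2\}$ such that $x$ is not between $y$ and $z$ in $L_i$.
   Context: For a poset $P$ and $x,y\in P$ with $x>y$, we say $x$ covers $y$ if there is no $z$ with $x>z>y$. The cover graph of $P$ has the elements of $P$ as vertices, with $\{x,y\}$ an edge when one of $x,y$ covers the other. The height of $P$ is the maximum size of a chain in $P$. The girth of a graph is the length of a shortest cycle, and $\chi(G)$ is the chromatic number. The eye parameter $\mathrm{eye}(G)$ of a graph $G$ is the least positive integer $s$ for which there exist linear orders $L_1,\dots,L_s$ on the vertex set of $G$ such that whenever $x,y,z$ are distinct vertices with $\{y,z\}$ an edge of $G$, there is some $i$ for which $x$ is not between $y$ and $z$ in $L_i$ (so $x$ is either above both or below both of $y,z$ in $L_i$). -}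

module Defs where

open import Level using (0ℓ)
open import Data.Nat using (ℕ; zero; suc; _≤_; _<_; _%_; _+_)
open import Data.Nat.Properties using ()
open import Data.Fin using (Fin; toℕ; fromℕ<)
open import Data.Nat.DivMod using (m%n<n)
open import Data.List using (List; length)
open import Data.List.Relation.Unary.Linked using (Linked)
open import Data.Product using (Σ; _×_; _,_; ∃)
open import Data.Sum using (_⊎_)
open import Relation.Nullary using (¬_)
open import Relation.Binary.PropositionalEquality using (_≡_)
open import Relation.Binary.Structures using (IsStrictPartialOrder; IsStrictTotalOrder)
open import Function.Definitions using (Injective)

Rel : ℕ → Set₁
Rel n = Fin n → Fin n → Set

IsFinitePoset : (n : ℕ) → Rel n → Set
IsFinitePoset n _<P_ = IsStrictPartialOrder _≡_ _<P_

Covers : {n : ℕ} → Rel n → Fin n → Fin n → Set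
Covers _<P_ x y = (y <P x) × ¬ (∃ λ z → (y <P z) × (z <P x))

CoverAdj : {n : ℕ} → Rel n → Fin n → Fin n → Set
CoverAdj R x y = Covers R x y ⊎ Covers R y x

-- a chain: a list of elements strictly increasing in P
-- (by transitivity, its elements are pairwise comparable and distinct)
IsChain : {n : ℕ} → Rel n → List (Fin n) → Set
IsChain R c = Linked R c

HeightIs : {n : ℕ} → Rel n → ℕ → Set
HeightIs R h = (Σ (List _) λ c → IsChain R c × length c ≡ h)
             × ((c : List _) → IsChain R c → length c ≤ h)

sucMod : {k : ℕ} → Fin (suc k) → Fin (suc k)
sucMod {k} i = fromℕ< (m%n<n (suc (toℕ i)) (suc k))

IsCycle : {n : ℕ} → (Fin n → Fin n → Set) → (k : ℕ) → (Fin k → Fin n) → Set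
IsCycle E zero v = Data.Empty.⊥
  where import Data.Empty
IsCycle E (suc k) v = (3 ≤ suc k) × Injective _≡_ _≡_ v × ((i : Fin (suc k)) → E (v i) (v (sucMod i)))

GirthAtLeast : {n : ℕ} → (Fin n → Fin n → Set) → ℕ → Set
GirthAtLeast {n} E g = (k : ℕ) (v : Fin k → Fin n) → IsCycle E k v → g ≤ k

ProperColouring : {n : ℕ} → (Fin n → Fin n → Set) → (k : ℕ) → (Fin n → Fin k) → Set
ProperColouring E k c = ∀ x y → E x y → ¬ (c x ≡ c y)

ChromaticIs : {n : ℕ} → (Fin n → Fin n → Set) → ℕ → Set
ChromaticIs {n} E r = (Σ (Fin n → Fin r) λ c → ProperColouring E r c)
                    × ((k : ℕ) (c : Fin n → Fin k) → ProperColouring E k c → r ≤ k)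

IsLinearExtension : {n : ℕ} → Rel n → Rel n → Set
IsLinearExtension {n} _<P_ _<L_ = IsStrictTotalOrder _≡_ _<L_ × (∀ x y → x <P y → x <L y)

Between : {n : ℕ} → Rel n → Fin n → Fin n → Fin n → Set
Between _<L_ x y z = ((y <L x) × (x <L z)) ⊎ ((z <L x) × (x <L y))

EyeWitness₂ : {n : ℕ} → (Fin n → Fin n → Set) → Rel n → Rel n → Set
EyeWitness₂ E L₁ L₂ = ∀ x y z → ¬ (x ≡ y) → ¬ (x ≡ z) → ¬ (y ≡ z) → E y z →
                      ¬ Between L₁ x y z ⊎ ¬ Between L₂ x y z

{-# OPTIONS --safe #-}

-- Descartes' construction raises the chromatic number by one: take a |G|-uniform hypergraph H
-- of large girth in which every colouring with χ(G) colours has a monochromatic hyperedge, add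
-- the vertices of H below a disjoint family of copies of G, one for each hyperedge, and match
-- each copy with its hyperedge. A closed walk projects to the incidence graph of H, so short
-- cycles do not arise. If the matchings follow L₁, then both extensions lift: in L₁ the vertices
-- matched with v come right after v, ordered by their copies, while in L₂ all of H comes first,
-- followed by the copies as blocks in the opposite order. What separates an edge in both orders
-- then already separates it inside a copy. This also makes every edge a cover relation.
--
-- H is obtained by the partite amalgamation of Nešetřil and Rödl, by induction on the girth:
-- start from disjoint hyperedges, one for each k-subset of n k + 1 levels, and for each level in
-- turn glue copies along a hypergraph of smaller girth, which makes some copy monochromatic on
-- that level.
module Submission where

open import Defs
open import Data.Nat using (ℕ; zero; suc; _+_; _*_; _≤_; _<_; z≤n; s≤s; _≟_)
open import Data.Nat.Properties
  using (+-assoc; +-comm; +-monoˡ-≤; ≤-refl; ≤-trans; ≤-reflexive; <-≤-trans; ≤-pred; m≤m+n;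
         m≤n+m; +-suc; n≤1+n; <-irrefl;
         ≤∧≢⇒<; <⇒≱; m<n⇒m<1+n; <⇒≤; +-cancelˡ-<; +-monoʳ-<; ∸-cancelʳ-<; ≮⇒≥; <-trans; <-asym;
         +-identityʳ)
open import Data.Nat.DivMod using (_mod_; m%n<n; m<n⇒m%n≡m; n%n≡0)
open import Data.Nat.Induction using (<-wellFounded)
open import Data.Fin as Fin using (Fin; zero; suc; toℕ; fromℕ<; punchOut; combine; opposite;
  inject≤; _↑ˡ_; _↑ʳ_)
import Data.Fin.Properties as Finₚ
open import Data.Product using (Σ; ∃; _×_; _,_; proj₁; proj₂)
open import Data.Product.Function.NonDependent.Propositional using (_×-↔_)
open import Data.Sum as Sum using (_⊎_; inj₁; inj₂; map₁; swap)
open import Data.Sum.Properties using (inj₁-injective; inj₂-injective)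
open import Data.Sum.Function.Propositional using (_⊎-↔_)
open import Data.List using (List; []; _∷_; map; length)
open import Data.List.Properties using (length-map)
open import Data.List.Relation.Unary.Linked as Linked using (Linked; [-]; _∷_)
import Data.List.Relation.Unary.Linked.Properties as Linkedₚ
open import Data.Empty using (⊥; ⊥-elim)
open import Function using (_∘_; _↔_; Inverse; mk↔ₛ′; Injection)
open import Function.Properties.Inverse using (↔-refl; ↔-sym; ↔-trans; ↔⇒↣)
open import Induction.WellFounded using (Acc; acc)
open import Relation.Nullary using (¬_; yes; no)
open import Relation.Nullary.Decidable using (_×-dec_)
open import Relation.Binary.Construct.Closure.Symmetric as SymClosure using (SymClosure; fwd; bwd)
open import Relation.Binary.Construct.Closure.Transitive using (TransClosure; [_]; _∷_; _++_)
open import Relation.Binary.Structures using (IsStrictTotalOrder)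
open import Relation.Unary using (Decidable)
open import Relation.Binary.Definitions using (DecidableEquality; Symmetric; tri<; tri≈; tri>)
open import Relation.Binary.PropositionalEquality
  using (_≡_; _≢_; refl; sym; trans; cong; cong₂; subst; subst₂; isEquivalence; resp₂)

-- Nonbacktracking walks, girth and immersions.

Graph : Set → Set₁
Graph W = W → W → Set

-- In Nonbacktracking A p x y n, the walk runs from x to y, and p is the vertex visited before x.
data Nonbacktracking {W : Set} (A : Graph W) : W → W → W → ℕ → Set where
  stop : ∀ {p x} → Nonbacktracking A p x x 0
  step : ∀ {p x z y n} → A x z → z ≢ p → Nonbacktracking A x z y n →
         Nonbacktracking A p x y (suc n)

-- Backtracking is allowed at the base point of the closed walk; a graph without
-- cycles shorter than g has no such walk either.
Girth≥ : {W : Set} → Graph W → ℕ → Set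
Girth≥ A g = ∀ {x z n} → A x z → Nonbacktracking A x z x n → suc n < g → ⊥

module _ {W W′ : Set} {A : Graph W} {A′ : Graph W′} (A-sym : Symmetric A) (f : W → W′)
         (f-hom : ∀ {x y} → A x y → A′ (f x) (f y))
         (f-locally-injective : ∀ {x y z} → A x y → A x z → f y ≡ f z → y ≡ z) where

  map-nonbacktracking : ∀ {p x y n} → A x p → Nonbacktracking A p x y n →
                        Nonbacktracking A′ (f p) (f x) (f y) n
  map-nonbacktracking _ stop = stop
  map-nonbacktracking xp (step xz z≢p w) =
    step (f-hom xz) (z≢p ∘ f-locally-injective xz xp) (map-nonbacktracking (A-sym xz) w)

  -- Nonbacktracking compares only two neighbours of one vertex, so local injectivity suffices and
  -- `f` may identify distant vertices.
  immersion-girth : ∀ {g} → Girth≥ A′ g → Girth≥ A g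
  immersion-girth girth xz w = girth (f-hom xz) (map-nonbacktracking (A-sym xz) w)

-- Attached and pendant vertices.

Attach : {Y I : Set} → Graph Y → (Y → I → Set) → Graph (Y ⊎ I)
Attach A T (inj₁ y) (inj₁ y′) = A y y′
Attach A T (inj₁ y) (inj₂ i) = T y i
Attach A T (inj₂ i) (inj₁ y) = T y i
Attach A T (inj₂ _) (inj₂ _) = ⊥

Attach-sym : {Y I : Set} {A : Graph Y} {T : Y → I → Set} →
             Symmetric A → Symmetric (Attach A T)
Attach-sym A-sym {inj₁ _} {inj₁ _} a = A-sym a
Attach-sym A-sym {inj₁ _} {inj₂ _} t = t
Attach-sym A-sym {inj₂ _} {inj₁ _} t = t

Incidence : {K I X : Set} → (K → I → X) → Graph (K ⊎ X)
Incidence at = Attach (λ _ _ → ⊥) (λ h x → ∃ λ i → at h i ≡ x)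

module Pendant {Y I : Set} {A : Graph Y} {T : Y → I → Set}
  (pendant : ∀ {i y y′} → T y i → T y′ i → y ≡ y′) where

  -- The only way out of a pendant vertex leads back to the vertex just left.
  dead-end : ∀ {y i b n} → T y i → Nonbacktracking (Attach A T) (inj₁ y) (inj₂ i) b n → b ≡ inj₂ i
  dead-end _ stop = refl
  dead-end t (step {z = inj₁ _} t′ ≢y _) = ⊥-elim (≢y (cong inj₁ (pendant t′ t)))

  to-base : ∀ {p y y′ n} → Nonbacktracking (Attach A T) (inj₁ p) (inj₁ y) (inj₁ y′) n →
            Nonbacktracking A p y y′ n
  to-base stop = stop
  to-base (step {z = inj₁ _} a ≢p w) = step a (≢p ∘ cong inj₁) (to-base w)
  to-base (step {z = inj₂ _} t _ w) with dead-end t w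
  ... | ()

  to-base-of-pendant : ∀ {p y i n} → Nonbacktracking (Attach A T) (inj₁ p) (inj₁ y) (inj₂ i) n →
                       ∃ λ y′ → ∃ λ m → T y′ i × n ≡ suc m × Nonbacktracking A p y y′ m
  to-base-of-pendant (step {z = inj₁ _} a ≢p w) with to-base-of-pendant w
  ... | y′ , m , t , refl , w′ = y′ , suc m , t , refl , step a (≢p ∘ cong inj₁) w′
  to-base-of-pendant (step {z = inj₂ _} t _ w) with dead-end t w
  to-base-of-pendant (step t _ stop) | refl = _ , 0 , t , refl , stop
  to-base-of-pendant (step t _ (step {z = inj₁ _} t′ ≢y _)) | refl =
    ⊥-elim (≢y (cong inj₁ (pendant t′ t)))

  -- A closed walk meets a pendant vertex only if it is based there; without its first and last
  -- steps it is then a closed walk of `A`.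
  pendant-girth : ∀ {g} → Girth≥ A g → Girth≥ (Attach A T) g
  pendant-girth girth {inj₁ y} {inj₁ _} a w = girth a (to-base w)
  pendant-girth girth {inj₁ y} {inj₂ _} t w with dead-end t w
  ... | ()
  pendant-girth girth {inj₂ i} {inj₁ y} t (step {z = inj₂ j} t′ ≢i w) with dead-end t′ w
  ... | refl = λ _ → ≢i refl
  pendant-girth girth {inj₂ i} {inj₁ y} t (step {z = inj₁ _} a _ w) with to-base-of-pendant w
  ... | y′ , m , t′ , refl , w′ with pendant t t′
  ... | refl = λ l → girth a w′ (≤-trans (n≤1+n _) (≤-trans (n≤1+n _) l))

-- Girth of glued copies.

-- The graph A with ports I attached by T; one copy per hyperedge h, with port i
-- identified with the vertex at h i of the hypergraph.
module Gluing {Y I K X : Set} (A : Graph Y) (T : Y → I → Set) (at : K → I → X)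
  (_≟ᴷ_ : DecidableEquality K)
  (at-injective : ∀ h {i j} → at h i ≡ at h j → i ≡ j)
  (port-unique : ∀ {y i j} → T y i → T y j → i ≡ j) where

  Open : Graph (Y ⊎ I)
  Open = Attach A T

  data Private : K × Y → K × Y → Set where
    within : ∀ {h y y′} → A y y′ → Private (h , y) (h , y′)

  Glued : Graph ((K × Y) ⊎ X)
  Glued = Attach Private (λ (h , y) x → ∃ λ i → T y i × at h i ≡ x)

  copy : K → Y ⊎ I → (K × Y) ⊎ X
  copy h (inj₁ y) = inj₁ (h , y)
  copy h (inj₂ i) = inj₂ (at h i)

  project : (K × Y) ⊎ X → K ⊎ X
  project = map₁ proj₁

  -- Cuts the walk where it first enters another copy. The vertex shared by `port` and `port′`
  -- precedes `rest`, so `rest` is again a walk entering a copy through a port, and recursion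
  -- applies.
  record Exit (h : K) (q u : Y ⊎ I) (b : (K × Y) ⊎ X) (n : ℕ) : Set where
    field
      {port port′} : I
      {next} : K
      {target} : Y
      {before after} : ℕ
      inside : Nonbacktracking Open q u (inj₂ port) before
      next≢ : next ≢ h
      same : at next port′ ≡ at h port
      attached : T target port′
      rest : Nonbacktracking Glued (inj₂ (at next port′)) (inj₁ (next , target)) b after
      total : before + suc after ≡ n

    after<n : after < n
    after<n = subst (after <_) total (m≤n+m (suc after) before)

  cons-exit : ∀ {h p x z b n} → Open x z → z ≢ p → Exit h x z b n → Exit h p x b (suc n)
  cons-exit a ≢p e = record
    { inside = step a ≢p inside ; next≢ = next≢ ; same = same ; attached = attached
    ; rest = rest ; total = cong suc total }
    where open Exit e

  Stay : K → (q u : Y ⊎ I) → (K × Y) ⊎ X → ℕ → Set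
  Stay h q u b n = ∃ λ u′ → copy h u′ ≡ b × Nonbacktracking Open q u u′ n

  cons : ∀ {h p x z b n} → Open x z → copy h z ≢ copy h p →
         Stay h x z b n ⊎ Exit h x z b n → Stay h p x b (suc n) ⊎ Exit h p x b (suc n)
  cons a ≢p (inj₁ (u′ , eq , w)) = inj₁ (u′ , eq , step a (≢p ∘ cong (copy _)) w)
  cons a ≢p (inj₂ e) = inj₂ (cons-exit a (≢p ∘ cong (copy _)) e)

  first-segment : ∀ h q u {b n} → Nonbacktracking Glued (copy h q) (copy h u) b n →
                  Stay h q u b n ⊎ Exit h q u b n
  first-segment h q u stop = inj₁ (u , refl , stop)
  first-segment h q (inj₁ y) (step {z = inj₁ _} (within a) ≢p w) =
    cons {z = inj₁ _} a ≢p (first-segment h _ _ w)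
  first-segment h q (inj₁ y) (step {z = inj₂ _} (j , t , refl) ≢p w) =
    cons {z = inj₂ j} t ≢p (first-segment h (inj₁ y) (inj₂ j) w)
  first-segment h q (inj₂ j) (step {z = inj₁ (h′ , y′)} (j′ , t , eq) ≢p w) with h′ ≟ᴷ h
  ... | no h′≢h = inj₂ record
    { inside = stop ; next≢ = h′≢h ; same = eq ; attached = t ; total = refl
    ; rest = subst (λ x → Nonbacktracking Glued (inj₂ x) _ _ _) (sym eq) w }
  ... | yes refl with at-injective h eq
  ... | refl = cons {z = inj₁ y′} t ≢p (first-segment h (inj₂ j) (inj₁ y′) w)

  -- A single step from `y` could only return to `i`, the one port attached to `y`.
  ports-far : ∀ {y i j n} → T y i → Nonbacktracking Open (inj₂ i) (inj₁ y) (inj₂ j) n → 2 ≤ n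
  ports-far t (step t′ ≢i stop) = ⊥-elim (≢i (cong inj₂ (port-unique t′ t)))
  ports-far t (step _ _ (step _ _ _)) = s≤s (s≤s z≤n)

  module _ {N : ℕ} (open-girth : Girth≥ Open N) where

    -- Leaving by the port of entry would close a walk of length `suc n` in `Open`. Hence the
    -- projected walk does not backtrack at `h`.
    port≢ : ∀ {y i j n} → T y i → Nonbacktracking Open (inj₂ i) (inj₁ y) (inj₂ j) n →
            suc n < N → ∀ h → _≢_ {A = K ⊎ X} (inj₂ (at h j)) (inj₂ (at h i))
    port≢ t w l h eq with at-injective h (inj₂-injective eq)
    ... | refl = open-girth {inj₂ _} {inj₁ _} t w l

    -- A walk entering copy h through port i projects to the incidence graph. The
    -- second bound on m is strict because every passage through a copy has length
    -- at least 3 and is projected to one of length 2.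
    project-walk : ∀ {n h y i b} → Acc _<_ n → T y i →
      Nonbacktracking Glued (inj₂ (at h i)) (inj₁ (h , y)) b n → suc n < N →
      ∃ λ m → Nonbacktracking (Incidence at) (inj₂ (at h i)) (inj₁ h) (project b) m
            × m ≤ n × (project b ≡ inj₁ h ⊎ suc m ≤ n)
    project-walk {n} {h} {y} {i} {b} (acc rs) t w l with first-segment h (inj₂ i) (inj₁ y) w
    ... | inj₁ (inj₁ _ , refl , _) = 0 , stop , z≤n , inj₁ refl
    ... | inj₁ (inj₂ j , refl , v) =
      1 , step (j , refl) (port≢ t v l h) stop , ≤-trans (n≤1+n 1) (ports-far t v)
        , inj₂ (ports-far t v)
    ... | inj₂ e = 2 + m , step (port , refl) port≢i (step (port′ , same) (next≢ ∘ inj₁-injective) w′)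
                   , ≤-trans (n≤1+n _) 3+m≤n , inj₂ 3+m≤n
      where
      open Exit e
      before+1 : ∀ {k} → 2 ≤ before → k ≤ after → 3 + k ≤ n
      before+1 (s≤s (s≤s _)) k≤ =
        subst (3 + _ ≤_) total (s≤s (s≤s (≤-trans (s≤s k≤) (m≤n+m (suc after) _))))
      before≤n : before ≤ n
      before≤n = subst (before ≤_) total (m≤m+n before _)
      port≢i : _≢_ {A = K ⊎ X} (inj₂ (at h port)) (inj₂ (at h i))
      port≢i = port≢ t inside (≤-trans (s≤s (s≤s before≤n)) l) h
      recursive = project-walk (rs after<n) attached rest
                    (≤-trans (s≤s after<n) (≤-trans (n≤1+n _) l))
      m = proj₁ recursive
      w′ : Nonbacktracking (Incidence at) (inj₂ (at h port)) (inj₁ next) (project b) m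
      w′ = subst (λ x → Nonbacktracking (Incidence at) (inj₂ x) (inj₁ next) (project b) m) same
             (proj₁ (proj₂ recursive))
      3+m≤n : 3 + m ≤ n
      3+m≤n = before+1 (ports-far t inside) (proj₁ (proj₂ (proj₂ recursive)))

    -- A closed walk that stays in one copy is closed in `Open`. Any other projects to a strictly
    -- shorter closed walk of the incidence graph, which is why `N` may exceed `s` by one.
    glued-girth : ∀ {s} → Girth≥ (Incidence at) s → N ≤ suc s → Girth≥ Glued N
    glued-girth inc N≤ {inj₂ _} {inj₁ (h , y)} (i , t , refl) w l
      with project-walk (<-wellFounded _) t w l
    ... | m , w′ , _ , inj₂ m<n =
      inc {inj₂ _} {inj₁ _} (i , refl) w′ (≤-pred (≤-trans (s≤s (s≤s m<n)) (≤-trans l N≤)))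
    glued-girth inc N≤ {inj₁ (h , y)} {z} a w l = from-copy z a w
      where
      start : ∀ u → Open (inj₁ y) u →
              Nonbacktracking Glued (inj₁ (h , y)) (copy h u) (inj₁ (h , y)) _ → ⊥
      start u a w with first-segment h (inj₁ y) u w
      ... | inj₁ (inj₁ _ , refl , v) = open-girth a v l
      ... | inj₂ e with project-walk (<-wellFounded _) (Exit.attached e) (Exit.rest e)
                       (≤-trans (s≤s (Exit.after<n e)) (≤-trans (n≤1+n _) l))
      -- This alternative ends the walk in copy `next`, but its base point lies in copy `h`.
      ...   | _ , _ , _ , inj₁ eq = Exit.next≢ e (sym (inj₁-injective eq))
      ...   | m , w′ , _ , inj₂ m<after =
        inc {inj₁ h} {inj₂ (at h (Exit.port e))} (Exit.port e , refl)
            (step (Exit.port′ e , Exit.same e) (Exit.next≢ e ∘ inj₁-injective)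
              (subst (λ x → Nonbacktracking (Incidence at) (inj₂ x) _ _ _) (Exit.same e) w′))
            (≤-pred (≤-trans (s≤s (s≤s (≤-trans (s≤s m<after) (Exit.after<n e)))) (≤-trans l N≤)))
      from-copy : ∀ z → Glued (inj₁ (h , y)) z →
                  Nonbacktracking Glued (inj₁ (h , y)) z (inj₁ (h , y)) _ → ⊥
      from-copy (inj₁ _) (within a) w = start (inj₁ _) a w
      from-copy (inj₂ _) (j , t , refl) w = start (inj₂ j) t w

-- Finite sets.

Finite : Set → Set
Finite A = ∃ λ n → A ↔ Fin n

Fin-finite : ∀ {n} → Finite (Fin n)
Fin-finite = _ , ↔-refl

infixr 1 _⊎-finite_
infixr 2 _×-finite_

_⊎-finite_ : {A B : Set} → Finite A → Finite B → Finite (A ⊎ B)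
(_ , f) ⊎-finite (_ , g) = _ , ↔-trans (f ⊎-↔ g) (↔-sym Finₚ.+↔⊎)

_×-finite_ : {A B : Set} → Finite A → Finite B → Finite (A × B)
(_ , f) ×-finite (_ , g) = _ , ↔-trans (f ×-↔ g) (↔-sym Finₚ.*↔×)

size : {A : Set} → Finite A → ℕ
size = proj₁

index : {A : Set} (f : Finite A) → A → Fin (size f)
index (_ , f) = Inverse.to f

index-injective : {A : Set} (f : Finite A) {x y : A} → index f x ≡ index f y → x ≡ y
index-injective (_ , f) = Injection.injective (↔⇒↣ f)

≟-finite : {A : Set} → Finite A → DecidableEquality A
≟-finite (_ , f) = Finₚ.inj⇒≟ (↔⇒↣ f)

-- Subsets as increasing injections.

data Subset : ℕ → ℕ → Set where
  [] : Subset 0 0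
  keep : ∀ {k a} → Subset k a → Subset (suc k) (suc a)
  skip : ∀ {k a} → Subset k a → Subset k (suc a)

pick : ∀ {k a} → Subset k a → Fin k → Fin a
pick (keep s) zero = zero
pick (keep s) (suc i) = suc (pick s i)
pick (skip s) i = suc (pick s i)

pick-mono : ∀ {k a} (s : Subset k a) {i j} → i Fin.< j → pick s i Fin.< pick s j
pick-mono (keep s) {zero} {suc j} _ = s≤s z≤n
pick-mono (keep s) {suc i} {suc j} (s≤s i<j) = s≤s (pick-mono s i<j)
pick-mono (skip s) i<j = s≤s (pick-mono s i<j)

empty : ∀ a → Subset 0 a
empty zero = []
empty (suc a) = skip (empty a)

infixr 9 _⊚_

_⊚_ : ∀ {k b a} → Subset b a → Subset k b → Subset k a
[] ⊚ [] = []
keep s ⊚ keep s′ = keep (s ⊚ s′)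
keep s ⊚ skip s′ = skip (s ⊚ s′)
skip s ⊚ s′ = skip (s ⊚ s′)

pick-⊚ : ∀ {k b a} (s : Subset b a) (s′ : Subset k b) i → pick (s ⊚ s′) i ≡ pick s (pick s′ i)
pick-⊚ (keep s) (keep s′) zero = refl
pick-⊚ (keep s) (keep s′) (suc i) = cong suc (pick-⊚ s s′ i)
pick-⊚ (keep s) (skip s′) i = cong suc (pick-⊚ s s′ i)
pick-⊚ (skip s) s′ i = cong suc (pick-⊚ s s′ i)

Subset-finite : ∀ k a → Finite (Subset k a)
Subset-finite zero zero = 1 , mk↔ₛ′ (λ _ → zero) (λ _ → []) (λ { zero → refl }) (λ { [] → refl })
Subset-finite (suc k) zero = 0 , mk↔ₛ′ (λ ()) (λ ()) (λ ()) (λ ())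
Subset-finite zero (suc a) with Subset-finite zero a
... | n , f = n , ↔-trans (mk↔ₛ′ (λ { (skip s) → s }) skip (λ _ → refl) (λ { (skip _) → refl })) f
Subset-finite (suc k) (suc a) with Subset-finite k a ⊎-finite Subset-finite (suc k) a
... | n , f = n , ↔-trans
  (mk↔ₛ′ (λ { (keep s) → inj₁ s ; (skip s) → inj₂ s }) (λ { (inj₁ s) → keep s ; (inj₂ s) → skip s })
    (λ { (inj₁ _) → refl ; (inj₂ _) → refl }) (λ { (keep _) → refl ; (skip _) → refl })) f

dichotomy : ∀ a k b {P : Fin a → Set} → Decidable P → k + b ≤ a →
            (Σ (Subset k a) λ s → ∀ i → P (pick s i)) ⊎ (Σ (Subset b a) λ s → ∀ i → ¬ P (pick s i))
dichotomy a zero b P? _ = inj₁ (empty a , λ ())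
dichotomy a (suc k) zero P? _ = inj₂ (empty a , λ ())
dichotomy (suc a) (suc k) (suc b) P? (s≤s k+b<a) with P? zero
... | yes p with dichotomy a k (suc b) (P? ∘ suc) k+b<a
...   | inj₁ (s , ps) = inj₁ (keep s , λ { zero → p ; (suc i) → ps i })
...   | inj₂ (s , ¬ps) = inj₂ (skip s , ¬ps)
dichotomy (suc a) (suc k) (suc b) P? (s≤s k+b<a) | no ¬p
  with dichotomy a (suc k) b (P? ∘ suc) (subst (_≤ a) (+-suc k b) k+b<a)
...   | inj₁ (s , ps) = inj₁ (skip s , ps)
...   | inj₂ (s , ¬ps) = inj₂ (keep s , λ { zero → ¬p ; (suc i) → ¬ps i })

-- Unavoidable hypergraphs.

Monochromatic : {K I X C : Set} → (K → I → X) → (X → C) → Set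
Monochromatic at c = ∃ λ h → ∃ λ d → ∀ i → c (at h i) ≡ d

-- Either colour `zero` occurs on `k` vertices, or `n * k + 1` vertices avoid it and `punchOut`
-- deletes that colour.
pigeonhole : ∀ n k (c : Fin (n * k + 1) → Fin n) → Monochromatic (pick {k}) c
-- The summand `1` leaves a vertex when no colour remains.
pigeonhole zero k c with c zero
... | ()
pigeonhole (suc n) k c with dichotomy _ k (n * k + 1) (λ i → zero Finₚ.≟ c i)
                              (≤-reflexive (sym (+-assoc k (n * k) 1)))
... | inj₁ (s , zeros) = s , zero , λ i → sym (zeros i)
... | inj₂ (s , ¬zeros) with pigeonhole n k (λ i → punchOut (¬zeros i))
...   | s′ , d , mono = s ⊚ s′ , suc d , λ i →
  trans (cong c (pick-⊚ s s′ i))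
    (trans (sym (Finₚ.punchIn-punchOut (¬zeros (pick s′ i)))) (cong suc (mono i)))

-- The levels serve twice: the amalgamation treats them one by one, and later they order the
-- vertices compatibly with every hyperedge.
record Hypergraph (k : ℕ) : Set₁ where
  field
    {V E} : Set
    V-finite : Finite V
    E-finite : Finite E
    at : E → Fin k → V
    level : V → ℕ
    levels : ℕ
    level< : ∀ v → level v < levels
    level-mono : ∀ e {i j} → i Fin.< j → level (at e i) < level (at e j)

  level-injective : ∀ e {i j} → level (at e i) ≡ level (at e j) → i ≡ j
  level-injective e {i} {j} eq with Finₚ.<-cmp i j
  ... | tri< i<j _ _ = ⊥-elim (<-irrefl eq (level-mono e i<j))
  ... | tri≈ _ i≡j _ = i≡j
  ... | tri> _ _ j<i = ⊥-elim (<-irrefl (sym eq) (level-mono e j<i))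

  at-injective : ∀ e {i j} → at e i ≡ at e j → i ≡ j
  at-injective e = level-injective e ∘ cong level

  HasGirth≥ : ℕ → Set
  HasGirth≥ = Girth≥ (Incidence at)

  Unavoidable : ℕ → Set
  Unavoidable n = (c : V → Fin n) → Monochromatic at c

  -- Interpolates between colourings that depend on the level alone, at `t = 0`, and arbitrary
  -- colourings, at `t = levels`.
  UnavoidableFrom : ℕ → ℕ → Set
  UnavoidableFrom t n = (c : V → Fin n) (γ : ℕ → Fin n) →
    (∀ v → t ≤ level v → c v ≡ γ (level v)) → Monochromatic at c

complete : ∀ n k → Hypergraph k
complete n k = record
  { V-finite = Fin-finite ; E-finite = Subset-finite k (n * k + 1)
  ; at = pick ; level = toℕ ; level< = Finₚ.toℕ<n ; level-mono = pick-mono }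

complete-unavoidable : ∀ n k → Hypergraph.Unavoidable (complete n k) n
complete-unavoidable = pigeonhole

matching : ∀ n k → Hypergraph k
matching n k = record
  { V-finite = Subset-finite k (n * k + 1) ×-finite Fin-finite
  ; E-finite = Subset-finite k (n * k + 1)
  ; at = λ s i → s , pick s i ; level = toℕ ∘ proj₂ ; level< = Finₚ.toℕ<n ∘ proj₂
  ; level-mono = pick-mono }

matching-unavoidable : ∀ n k → Hypergraph.UnavoidableFrom (matching n k) 0 n
matching-unavoidable n k c γ c≡γ with pigeonhole n k (γ ∘ toℕ)
... | s , d , mono = s , d , λ i → trans (c≡γ _ z≤n) (mono i)

-- Each vertex names its only possible hyperedge, so the incidence graph consists of stars and
-- isolated vertices.
matching-girth : ∀ n k {g} → Hypergraph.HasGirth≥ (matching n k) g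
matching-girth n k {x = inj₁ _} {inj₂ _} (_ , eq) (step {z = inj₁ _} (_ , eq′) ≢s _) _ =
  ≢s (cong (inj₁ ∘ proj₁) (trans eq′ (sym eq)))
matching-girth n k {x = inj₂ _} {inj₁ _} _ (step {z = inj₂ _} _ ≢v stop) _ = ≢v refl
matching-girth n k {x = inj₂ _} {inj₁ _} _
  (step {z = inj₂ _} (_ , eq) _ (step {z = inj₁ _} (_ , eq′) ≢s _)) _ =
  ≢s (cong (inj₁ ∘ proj₁) (trans eq′ (sym eq)))

-- Partite amalgamation.

-- The Nešetřil–Rödl amalgamation: one copy of P for every hyperedge h of H, where the
-- vertices of level t are replaced by the vertices of h. The replaced vertices
-- remain as isolated vertices (h , v), and h has an unused vertex for each v not of level t.
module Amalgam {k : ℕ} (P : Hypergraph k) (t : ℕ) (t< : t < Hypergraph.levels P)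
  (H : Hypergraph (size (Hypergraph.V-finite P))) where

  open Hypergraph P
  private module H = Hypergraph H

  place : H.E → V → H.V ⊎ (H.E × V)
  place h v with level v ≟ t
  ... | yes _ = inj₁ (H.at h (index V-finite v))
  ... | no _ = inj₂ (h , v)

  amalgam-level : H.V ⊎ (H.E × V) → ℕ
  amalgam-level (inj₁ _) = t
  amalgam-level (inj₂ (_ , v)) = level v

  place-level : ∀ h v → amalgam-level (place h v) ≡ level v
  place-level h v with level v ≟ t
  ... | yes eq = sym eq
  ... | no _ = refl

  amalgam : Hypergraph k
  amalgam = record
    { V-finite = H.V-finite ⊎-finite H.E-finite ×-finite V-finite
    ; E-finite = H.E-finite ×-finite E-finite
    ; at = λ (h , e) i → place h (at e i)
    ; level = amalgam-level
    ; levels = levels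
    ; level< = λ { (inj₁ _) → t< ; (inj₂ (_ , v)) → level< v }
    ; level-mono = λ (h , e) {i} {j} i<j →
        subst (_< amalgam-level (place h (at e j))) (sym (place-level h (at e i)))
          (subst (level (at e i) <_) (sym (place-level h (at e j))) (level-mono e i<j)) }

  amalgam-unavoidable : ∀ {n} → H.Unavoidable n → UnavoidableFrom t n →
                        Hypergraph.UnavoidableFrom amalgam (suc t) n
  amalgam-unavoidable {n} H-unavoidable P-unavoidable c γ c≡γ with H-unavoidable (c ∘ inj₁)
  ... | h , d , mono with P-unavoidable (c ∘ place h) γ′ c≡γ′
    where
    -- On the copy over the monochromatic hyperedge `h`, level `t` also has a single colour, namely
    -- `d`.
    γ′ : ℕ → Fin n
    γ′ l with l ≟ t
    ... | yes _ = d
    ... | no _ = γ l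
    c≡γ′ : ∀ v → t ≤ level v → c (place h v) ≡ γ′ (level v)
    c≡γ′ v t≤ with level v ≟ t
    ... | yes _ = mono _
    ... | no ≢t = c≡γ (inj₂ (h , v)) (≤∧≢⇒< t≤ (≢t ∘ sym))
  ... | e , d′ , mono′ = (h , e) , d′ , mono′

  -- Incidences at level `t` become ports, the others stay private to a copy. Thus `V` occurs twice
  -- in `Open`, which `merge` undoes.
  Ordinary : Graph (E ⊎ V)
  Ordinary = Attach (λ _ _ → ⊥) (λ e v → level v ≢ t × ∃ λ i → at e i ≡ v)

  Port : E ⊎ V → V → Set
  Port (inj₁ e) v = level v ≡ t × ∃ λ i → at e i ≡ v
  Port (inj₂ _) v = ⊥

  port-unique : ∀ {y v w} → Port y v → Port y w → v ≡ w
  port-unique {inj₁ e} (eq , i , refl) (eq′ , j , refl) =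
    cong (at e) (level-injective e (trans eq (sym eq′)))

  open Gluing Ordinary Port (λ h v → H.at h (index V-finite v)) (≟-finite H.E-finite)
    (λ h → index-injective V-finite ∘ H.at-injective h) port-unique

  merge : (E ⊎ V) ⊎ V → E ⊎ V
  merge (inj₁ y) = y
  merge (inj₂ v) = inj₂ v

  Ordinary-sym : Symmetric Ordinary
  Ordinary-sym {x} {y} = Attach-sym (λ ()) {x} {y}

  merge-hom : ∀ {x y} → Open x y → Incidence at (merge x) (merge y)
  merge-hom {inj₁ (inj₁ _)} {inj₁ (inj₂ _)} (_ , a) = a
  merge-hom {inj₁ (inj₂ _)} {inj₁ (inj₁ _)} (_ , a) = a
  merge-hom {inj₁ (inj₁ _)} {inj₂ _} (_ , a) = a
  merge-hom {inj₂ _} {inj₁ (inj₁ _)} (_ , a) = a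

  -- Only the two occurrences of one `v` can merge, and a common neighbour would put `v` both on and
  -- off level `t`.
  merge-locally-injective : ∀ {x y z} → Open x y → Open x z → merge y ≡ merge z → y ≡ z
  merge-locally-injective {_} {inj₁ _} {inj₁ _} _ _ refl = refl
  merge-locally-injective {_} {inj₂ _} {inj₂ _} _ _ refl = refl
  merge-locally-injective {inj₁ (inj₁ _)} {inj₁ (inj₂ _)} {inj₂ _} (≢t , _) (≡t , _) refl =
    ⊥-elim (≢t ≡t)
  merge-locally-injective {inj₁ (inj₁ _)} {inj₂ _} {inj₁ (inj₂ _)} (≡t , _) (≢t , _) refl =
    ⊥-elim (≢t ≡t)

  -- Embeds the incidence graph of `amalgam` into `Glued`, so that the girth bound for gluing
  -- applies.
  split : (H.E × E) ⊎ (H.V ⊎ (H.E × V)) → (H.E × (E ⊎ V)) ⊎ H.V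
  split (inj₁ (h , e)) = inj₁ (h , inj₁ e)
  split (inj₂ (inj₁ x)) = inj₂ x
  split (inj₂ (inj₂ (h , v))) = inj₁ (h , inj₂ v)

  split-injective : ∀ {x y} → split x ≡ split y → x ≡ y
  split-injective {inj₁ _} {inj₁ _} refl = refl
  split-injective {inj₂ (inj₁ _)} {inj₂ (inj₁ _)} refl = refl
  split-injective {inj₂ (inj₂ _)} {inj₂ (inj₂ _)} refl = refl
  split-injective {inj₁ _} {inj₂ (inj₁ _)} ()
  split-injective {inj₁ _} {inj₂ (inj₂ _)} ()
  split-injective {inj₂ (inj₁ _)} {inj₁ _} ()
  split-injective {inj₂ (inj₂ _)} {inj₁ _} ()
  split-injective {inj₂ (inj₁ _)} {inj₂ (inj₂ _)} ()
  split-injective {inj₂ (inj₂ _)} {inj₂ (inj₁ _)} ()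

  split-place : ∀ h e i → Glued (inj₁ (h , inj₁ e)) (split (inj₂ (place h (at e i))))
                        × Glued (split (inj₂ (place h (at e i)))) (inj₁ (h , inj₁ e))
  split-place h e i with level (at e i) ≟ t
  ... | yes ≡t = (at e i , (≡t , i , refl) , refl) , (at e i , (≡t , i , refl) , refl)
  ... | no ≢t = within (≢t , i , refl) , within (≢t , i , refl)

  split-hom : ∀ {x y} → Incidence (Hypergraph.at amalgam) x y → Glued (split x) (split y)
  split-hom {inj₁ (h , e)} {inj₂ _} (i , refl) = proj₁ (split-place h e i)
  split-hom {inj₂ _} {inj₁ (h , e)} (i , refl) = proj₂ (split-place h e i)

  -- Two vertices of level t are far apart in P, which makes the girth grow.
  amalgam-girth : ∀ {s} → H.HasGirth≥ s → HasGirth≥ (suc s) →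
                  Hypergraph.HasGirth≥ amalgam (suc s)
  amalgam-girth H-girth P-girth =
    immersion-girth (λ {x} {y} → Attach-sym (λ ()) {x} {y}) split
      (λ {x} {y} → split-hom {x} {y}) (λ _ _ → split-injective)
      (glued-girth
        (immersion-girth (λ {x} {y} → Attach-sym (λ {x} {y} → Ordinary-sym {x} {y}) {x} {y}) merge
          (λ {x} {y} → merge-hom {x} {y}) (λ {x} → merge-locally-injective {x}) P-girth)
        port-incidence ≤-refl)
    where
    port-incidence : Girth≥ (Incidence (λ h v → H.at h (index V-finite v))) _
    port-incidence = immersion-girth (λ {x} {y} → Attach-sym (λ ()) {x} {y}) (λ x → x)
      (λ {x} {y} → hom {x} {y}) (λ _ _ eq → eq) H-girth
      where
      hom : ∀ {x y} → Incidence (λ h v → H.at h (index V-finite v)) x y → Incidence H.at x y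
      hom {inj₁ _} {inj₂ _} (v , eq) = index V-finite v , eq
      hom {inj₂ _} {inj₁ _} (v , eq) = index V-finite v , eq

-- Induction on the girth.

SparseUnavoidable : ℕ → ℕ → ℕ → Set₁
SparseUnavoidable s n k = Σ (Hypergraph k) λ H → Hypergraph.HasGirth≥ H s × Hypergraph.Unavoidable H n

module _ {s n : ℕ} (sparse : ∀ k → SparseUnavoidable s n k) (k : ℕ) where

  -- The uniformity of the next `H` is the number of vertices built so far, hence `sparse` is
  -- assumed for every uniformity.
  partite : ∀ t → t ≤ n * k + 1 →
            Σ (Hypergraph k) λ P → Hypergraph.levels P ≡ n * k + 1 ×
            Hypergraph.HasGirth≥ P (suc s) × Hypergraph.UnavoidableFrom P t n
  partite zero _ = matching n k , refl , matching-girth n k , matching-unavoidable n k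
  partite (suc t) t< with partite t (<⇒≤ t<)
  ... | P , refl , P-girth , P-unavoidable with sparse (size (Hypergraph.V-finite P))
  ...   | H , H-girth , H-unavoidable =
    amalgam , refl , amalgam-girth H-girth P-girth , amalgam-unavoidable H-unavoidable P-unavoidable
    where open Amalgam P t t< H

sparse-unavoidable : ∀ s n k → SparseUnavoidable s (suc n) k
sparse-unavoidable zero n k = complete (suc n) k , (λ _ _ ()) , complete-unavoidable (suc n) k
sparse-unavoidable (suc s) n k with partite (sparse-unavoidable s n) k _ ≤-refl
... | P , refl , P-girth , P-unavoidable =
  -- No vertex reaches level `levels`, so any `γ` will do; a constant one exists because there are
  -- `suc n` colours.
  P , P-girth , λ c → P-unavoidable c (λ _ → zero) (λ v l → ⊥-elim (<⇒≱ (Hypergraph.level< P v) l))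

-- Lexicographic, reversed and concatenated finite orders.

combine-<⁻ : ∀ {m n} (i j : Fin m) {k l : Fin n} → combine i k Fin.< combine j l →
             i Fin.< j ⊎ (i ≡ j × k Fin.< l)
combine-<⁻ {n = n} i j {k} {l} lt with Finₚ.<-cmp i j
... | tri< i<j _ _ = inj₁ i<j
... | tri> _ _ j<i = ⊥-elim (<-asym lt (Finₚ.combine-monoˡ-< l k j<i))
... | tri≈ _ refl _ = inj₂ (refl ,
  +-cancelˡ-< (n * toℕ i) _ _ (subst₂ _<_ (Finₚ.toℕ-combine i k) (Finₚ.toℕ-combine i l) lt))

combine-monoʳ-< : ∀ {m n} (i : Fin m) {k l : Fin n} → k Fin.< l → combine i k Fin.< combine i l
combine-monoʳ-< {n = n} i {k} {l} k<l =
  subst₂ _<_ (sym (Finₚ.toℕ-combine i k)) (sym (Finₚ.toℕ-combine i l)) (+-monoʳ-< (n * toℕ i) k<l)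

opposite-<⁻ : ∀ {n} {i j : Fin n} → opposite i Fin.< opposite j → j Fin.< i
opposite-<⁻ {n} {i} {j} lt =
  ≤-pred (∸-cancelʳ-< {o = n} (subst₂ _<_ (Finₚ.opposite-prop i) (Finₚ.opposite-prop j) lt))

opposite-injective : ∀ {n} {i j : Fin n} → opposite i ≡ opposite j → i ≡ j
opposite-injective {i = i} {j} eq =
  trans (sym (Finₚ.opposite-involutive i)) (trans (cong opposite eq) (Finₚ.opposite-involutive j))

↑ʳ-<⁻ : ∀ {m} n {i j : Fin m} → n ↑ʳ i Fin.< n ↑ʳ j → i Fin.< j
↑ʳ-<⁻ n {i} {j} lt = +-cancelˡ-< n _ _ (subst₂ _<_ (Finₚ.toℕ-↑ʳ n i) (Finₚ.toℕ-↑ʳ n j) lt)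

↑ʳ-mono-< : ∀ {m} n {i j : Fin m} → i Fin.< j → n ↑ʳ i Fin.< n ↑ʳ j
↑ʳ-mono-< n {i} {j} lt =
  subst₂ _<_ (sym (Finₚ.toℕ-↑ʳ n i)) (sym (Finₚ.toℕ-↑ʳ n j)) (+-monoʳ-< n lt)

↑ˡ<↑ʳ : ∀ {m n} (i : Fin m) (j : Fin n) → i ↑ˡ n Fin.< m ↑ʳ j
↑ˡ<↑ʳ {m} {n} i j = subst₂ _<_ (sym (Finₚ.toℕ-↑ˡ i n)) (sym (Finₚ.toℕ-↑ʳ m j))
  (<-≤-trans (Finₚ.toℕ<n i) (m≤m+n m (toℕ j)))

-- Plane diagrams.

-- A Hasse diagram drawn in the plane with coordinates rank₁ and rank₂: x ⋖ y goes
-- upwards in both, and the rectangle spanned by an edge contains no other vertex.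
record Diagram (V : Set) (g m : ℕ) : Set₁ where
  field
    _⋖_ : V → V → Set
    girth : Girth≥ (SymClosure _⋖_) g
    colour : V → Fin (suc m)
    colour-mono : ∀ {x y} → x ⋖ y → colour x Fin.< colour y
    uncolourable : (c : V → Fin m) → ¬ (∀ {x y} → x ⋖ y → c x ≢ c y)
    bottom : V
    above : List V
    chain : Linked _⋖_ (bottom ∷ above)
    length-above : length above ≡ m
    {R₁ R₂} : ℕ
    rank₁ : V → Fin R₁
    rank₂ : V → Fin R₂
    rank₁-injective : ∀ {x y} → rank₁ x ≡ rank₁ y → x ≡ y
    rank₂-injective : ∀ {x y} → rank₂ x ≡ rank₂ y → x ≡ y
    rank₁-mono : ∀ {x y} → x ⋖ y → rank₁ x Fin.< rank₁ y
    rank₂-mono : ∀ {x y} → x ⋖ y → rank₂ x Fin.< rank₂ y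
    empty-rectangle : ∀ {x y z} → y ⋖ z → rank₁ y Fin.< rank₁ x → rank₁ x Fin.< rank₁ z →
                      rank₂ y Fin.< rank₂ x → rank₂ x Fin.< rank₂ z → ⊥

relabel : ∀ {V W g m} → V ↔ W → Diagram V g m → Diagram W g m
relabel {V} {W} f D = record
  { _⋖_ = λ x y → from x ⋖ from y
  ; girth = immersion-girth (SymClosure.symmetric _) from from-hom (λ _ _ → from-injective) girth
  ; colour = colour ∘ from
  ; colour-mono = colour-mono
  ; uncolourable = λ c proper → uncolourable (c ∘ to)
      λ x⋖y → proper (subst₂ _⋖_ (sym (from-to _)) (sym (from-to _)) x⋖y)
  ; bottom = to bottom
  ; above = map to above
  ; chain = Linkedₚ.map⁺ (Linked.map (subst₂ _⋖_ (sym (from-to _)) (sym (from-to _))) chain)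
  ; length-above = trans (length-map to above) length-above
  ; rank₁ = rank₁ ∘ from
  ; rank₂ = rank₂ ∘ from
  ; rank₁-injective = from-injective ∘ rank₁-injective
  ; rank₂-injective = from-injective ∘ rank₂-injective
  ; rank₁-mono = rank₁-mono
  ; rank₂-mono = rank₂-mono
  ; empty-rectangle = empty-rectangle
  }
  where
  open Diagram D
  open Inverse f using (to; from)
  from-to : ∀ x → from (to x) ≡ x
  from-to = Inverse.strictlyInverseʳ f
  from-injective : ∀ {x y} → from x ≡ from y → x ≡ y
  from-injective = Injection.injective (↔⇒↣ (↔-sym f))
  from-hom : ∀ {x y} → SymClosure (λ x y → from x ⋖ from y) x y → SymClosure _⋖_ (from x) (from y)
  from-hom (fwd a) = fwd a
  from-hom (bwd a) = bwd a

point : ∀ g → Diagram (Fin 1) g 0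
point g = record
  { _⋖_ = λ _ _ → ⊥
  ; girth = λ { (fwd ()) ; (bwd ()) }
  ; colour = λ x → x
  ; colour-mono = λ ()
  ; uncolourable = λ c _ → Finₚ.¬Fin0 (c zero)
  ; bottom = zero
  ; above = []
  ; chain = [-]
  ; length-above = refl
  ; rank₁ = λ x → x
  ; rank₂ = λ x → x
  ; rank₁-injective = λ eq → eq
  ; rank₂-injective = λ eq → eq
  ; rank₁-mono = λ ()
  ; rank₂-mono = λ ()
  ; empty-rectangle = λ ()
  }

-- Raising the chromatic number.

-- The construction of Descartes: new minimal vertices H.V and, for every hyperedge h,
-- a copy of D whose vertices are matched with the vertices of h in the order of rank₁;
-- positions of h that are not the rank of a vertex stay unmatched.
module Descartes {V : Set} {g m : ℕ} (D : Diagram V g m)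
  (H : Hypergraph (Diagram.R₁ D)) (H-girth : Hypergraph.HasGirth≥ H g)
  (H-unavoidable : Hypergraph.Unavoidable H (suc m)) where

  open Diagram D
  private module H = Hypergraph H

  V⁺ : Set
  V⁺ = (H.E × V) ⊎ H.V

  foot : H.E → V → H.V
  foot h x = H.at h (rank₁ x)

  data _◁_ : V⁺ → V⁺ → Set where
    match : ∀ h x → inj₂ (foot h x) ◁ inj₁ (h , x)
    lift : ∀ h {x y} → x ⋖ y → inj₁ (h , x) ◁ inj₁ (h , y)

  port-unique : ∀ {x i j} → rank₁ x ≡ i → rank₁ x ≡ j → i ≡ j
  port-unique refl refl = refl

  open Gluing (SymClosure _⋖_) (λ x i → rank₁ x ≡ i) H.at (≟-finite H.E-finite) H.at-injective
    port-unique

  ◁-glued : ∀ {x y} → SymClosure _◁_ x y → Glued x y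
  ◁-glued (fwd (match h x)) = rank₁ x , refl , refl
  ◁-glued (bwd (match h x)) = rank₁ x , refl , refl
  ◁-glued (fwd (lift h a)) = within (fwd a)
  ◁-glued (bwd (lift h a)) = within (bwd a)

  -- Since `rank₁` is injective, each port is attached to at most one vertex, so `Open` inherits the
  -- girth of `D`.
  ◁-girth : Girth≥ (SymClosure _◁_) g
  ◁-girth = immersion-girth (SymClosure.symmetric _◁_) (λ x → x) ◁-glued (λ _ _ eq → eq)
    (glued-girth (Pendant.pendant-girth (λ eq eq′ → rank₁-injective (trans eq (sym eq′))) girth)
      H-girth (n≤1+n g))

  colour⁺ : V⁺ → Fin (2 + m)
  colour⁺ (inj₁ (h , x)) = suc (colour x)
  colour⁺ (inj₂ _) = zero

  colour⁺-mono : ∀ {x y} → x ◁ y → colour⁺ x Fin.< colour⁺ y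
  colour⁺-mono (match h x) = s≤s z≤n
  colour⁺-mono (lift h a) = s≤s (colour-mono a)

  -- The copy over a monochromatic hyperedge avoids its colour `d`, which would leave `m` colours
  -- for `D`.
  ◁-uncolourable : (c : V⁺ → Fin (suc m)) → ¬ (∀ {x y} → x ◁ y → c x ≢ c y)
  ◁-uncolourable c proper with H-unavoidable (c ∘ inj₂)
  ... | h , d , mono = uncolourable (λ x → punchOut (avoids x))
    λ a eq → proper (lift h a) (Finₚ.punchOut-injective (avoids _) (avoids _) eq)
    where
    avoids : ∀ x → d ≢ c (inj₁ (h , x))
    avoids x eq = proper (match h x) (trans (mono (rank₁ x)) eq)

  some-edge : H.E
  some-edge = proj₁ (H-unavoidable (λ _ → zero))

  level : H.V → Fin H.levels
  level v = fromℕ< (H.level< v)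

  -- A linear order refining the levels; the index breaks ties.
  position : H.V → Fin (H.levels * size H.V-finite)
  position v = combine (level v) (index H.V-finite v)

  position-injective : ∀ {v w} → position v ≡ position w → v ≡ w
  position-injective {v} {w} eq =
    index-injective H.V-finite (Finₚ.combine-injectiveʳ (level v) _ (level w) _ eq)

  foot-mono : ∀ h {x y} → rank₁ x Fin.< rank₁ y → position (foot h x) Fin.< position (foot h y)
  foot-mono h {x} {y} lt = Finₚ.combine-monoˡ-< {i = level (foot h x)} {level (foot h y)} _ _
    (subst₂ _<_ (sym (Finₚ.toℕ-fromℕ< _)) (sym (Finₚ.toℕ-fromℕ< _)) (H.level-mono h lt))

  number : H.E → Fin (size H.E-finite)
  number = index H.E-finite

  number-injective : ∀ {h f} → number h ≡ number f → h ≡ f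
  number-injective = index-injective H.E-finite

  -- First coordinate: every vertex of H is followed by the vertices matched with it, in the
  -- order of their copies. Second coordinate: H.V, followed by the copies in reverse order.
  rank₁⁺ : V⁺ → Fin (H.levels * size H.V-finite * suc (size H.E-finite))
  rank₁⁺ (inj₁ (h , x)) = combine (position (foot h x)) (suc (number h))
  rank₁⁺ (inj₂ v) = combine (position v) zero

  rank₂⁺ : V⁺ → Fin (size H.V-finite + size H.E-finite * R₂)
  rank₂⁺ (inj₁ (h , x)) = size H.V-finite ↑ʳ combine (opposite (number h)) (rank₂ x)
  rank₂⁺ (inj₂ v) = index H.V-finite v ↑ˡ _

  rank₁⁺-injective : ∀ {x y} → rank₁⁺ x ≡ rank₁⁺ y → x ≡ y
  rank₁⁺-injective {inj₁ (h , x)} {inj₁ (f , y)} eq 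
    with Finₚ.combine-injective (position (foot h x)) _ (position (foot f y)) _ eq
  ... | p , q with number-injective {h} {f} (Finₚ.suc-injective q)
  ... | refl = cong (λ x → inj₁ (h , x)) (rank₁-injective (H.at-injective h (position-injective p)))
  rank₁⁺-injective {inj₁ (h , x)} {inj₂ v} eq
    with Finₚ.combine-injectiveʳ (position (foot h x)) _ _ _ eq
  ... | ()
  rank₁⁺-injective {inj₂ v} {inj₁ (h , x)} eq with Finₚ.combine-injectiveʳ (position v) _ _ _ eq
  ... | ()
  rank₁⁺-injective {inj₂ v} {inj₂ w} eq =
    cong inj₂ (position-injective (Finₚ.combine-injectiveˡ _ _ _ _ eq))

  rank₂⁺-injective : ∀ {x y} → rank₂⁺ x ≡ rank₂⁺ y → x ≡ y
  rank₂⁺-injective {inj₁ (h , x)} {inj₁ (f , y)} eq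
    with Finₚ.combine-injective _ _ _ _ (Finₚ.↑ʳ-injective _ _ _ eq)
  ... | p , q = cong inj₁ (cong₂ _,_ (number-injective (opposite-injective p)) (rank₂-injective q))
  rank₂⁺-injective {inj₁ _} {inj₂ _} eq = ⊥-elim (<-irrefl (cong toℕ (sym eq)) (↑ˡ<↑ʳ _ _))
  rank₂⁺-injective {inj₂ _} {inj₁ _} eq = ⊥-elim (<-irrefl (cong toℕ eq) (↑ˡ<↑ʳ _ _))
  rank₂⁺-injective {inj₂ v} {inj₂ w} eq =
    cong inj₂ (index-injective H.V-finite (Finₚ.↑ˡ-injective _ _ _ eq))

  rank₁⁺-mono : ∀ {x y} → x ◁ y → rank₁⁺ x Fin.< rank₁⁺ y
  rank₁⁺-mono (match h x) = combine-monoʳ-< (position (foot h x)) {zero} {suc (number h)} (s≤s z≤n)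
  rank₁⁺-mono (lift h a) = Finₚ.combine-monoˡ-< _ _ (foot-mono h (rank₁-mono a))

  rank₂⁺-mono : ∀ {x y} → x ◁ y → rank₂⁺ x Fin.< rank₂⁺ y
  rank₂⁺-mono (match h x) = ↑ˡ<↑ʳ _ _
  rank₂⁺-mono (lift h a) = ↑ʳ-mono-< _ (combine-monoʳ-< (opposite (number h)) (rank₂-mono a))

  rank₁⁺-<⁻ : ∀ h {x y} → rank₁⁺ (inj₁ (h , x)) Fin.< rank₁⁺ (inj₁ (h , y)) → rank₁ x Fin.< rank₁ y
  rank₁⁺-<⁻ h {x} {y} lt with Finₚ.<-cmp (rank₁ x) (rank₁ y)
  ... | tri< x<y _ _ = x<y
  ... | tri≈ _ x≡y _ with rank₁-injective x≡y
  ...   | refl = ⊥-elim (<-irrefl refl lt)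
  rank₁⁺-<⁻ h lt | tri> _ _ y<x =
    ⊥-elim (<-asym lt (Finₚ.combine-monoˡ-< _ _ (foot-mono h y<x)))

  rank₂⁺-<⁻ : ∀ {h f x y} → rank₂⁺ (inj₁ (h , x)) Fin.< rank₂⁺ (inj₁ (f , y)) →
              number f Fin.< number h ⊎ (h ≡ f × rank₂ x Fin.< rank₂ y)
  rank₂⁺-<⁻ {h} {f} lt with combine-<⁻ (opposite (number h)) (opposite (number f)) (↑ʳ-<⁻ _ lt)
  ... | inj₁ lt′ = inj₁ (opposite-<⁻ lt′)
  ... | inj₂ (eq , lt′) = inj₂ (number-injective (opposite-injective eq) , lt′)

  -- Both bounds lie in the block of `foot h z`, where the number of the copy decides.
  rank₁⁺-foot-<⁻ : ∀ {h f x z} → rank₁⁺ (inj₂ (foot h z)) Fin.< rank₁⁺ (inj₁ (f , x)) →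
                   rank₁⁺ (inj₁ (f , x)) Fin.< rank₁⁺ (inj₁ (h , z)) → number f Fin.< number h
  rank₁⁺-foot-<⁻ {h} {f} {x} {z} p q
    with combine-<⁻ (position (foot h z)) (position (foot f x)) p
       | combine-<⁻ (position (foot f x)) (position (foot h z)) q
  ... | _ | inj₂ (_ , s≤s lt) = lt
  ... | inj₁ lt | inj₁ gt = ⊥-elim (<-asym lt gt)
  ... | inj₂ (eq , _) | inj₁ gt = ⊥-elim (<-irrefl (cong toℕ (sym eq)) gt)

  -- Between the ends of a matching edge the first order has only vertices of copies with smaller
  -- number, which the second puts above the edge. For a lifted edge the second order confines `x`
  -- to copy `h`, where `D` decides.
  ◁-empty-rectangle : ∀ {x y z} → y ◁ z → rank₁⁺ y Fin.< rank₁⁺ x → rank₁⁺ x Fin.< rank₁⁺ z →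
                      rank₂⁺ y Fin.< rank₂⁺ x → rank₂⁺ x Fin.< rank₂⁺ z → ⊥
  ◁-empty-rectangle {inj₁ (f , x)} (match h z) p q r s with rank₂⁺-<⁻ {f} {h} {x} {z} s
  ... | inj₁ h<f = <-asym h<f (rank₁⁺-foot-<⁻ {h} {f} {x} {z} p q)
  ... | inj₂ (refl , _) = <-irrefl refl (rank₁⁺-foot-<⁻ {h} {f} {x} {z} p q)
  ◁-empty-rectangle {inj₂ v} (match h z) p q r s
    with combine-<⁻ (position (foot h z)) (position v) p
       | combine-<⁻ (position v) (position (foot h z)) q
  ... | inj₁ lt | inj₁ gt = <-asym lt gt
  ... | inj₁ lt | inj₂ (eq , _) = <-irrefl (cong toℕ (sym eq)) lt
  ... | inj₂ (_ , ()) | _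
  ◁-empty-rectangle {inj₂ v} (lift h a) p q r s = <-asym r (↑ˡ<↑ʳ _ _)
  ◁-empty-rectangle {inj₁ (f , x)} (lift h {y} {z} a) p q r s
    with rank₂⁺-<⁻ {h} {f} {y} {x} r | rank₂⁺-<⁻ {f} {h} {x} {z} s
  ... | inj₁ lt | inj₁ gt = <-asym lt gt
  ... | inj₁ lt | inj₂ (refl , _) = <-irrefl refl lt
  ... | inj₂ (refl , _) | inj₁ gt = <-irrefl refl gt
  ... | inj₂ (refl , r′) | inj₂ (_ , s′) =
    empty-rectangle a (rank₁⁺-<⁻ h p) (rank₁⁺-<⁻ h q) r′ s′

  descartes : Diagram V⁺ g (suc m)
  descartes = record
    { _⋖_ = _◁_
    ; girth = ◁-girth
    ; colour = colour⁺
    ; colour-mono = colour⁺-mono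
    ; uncolourable = ◁-uncolourable
    ; bottom = inj₂ (foot some-edge bottom)
    ; above = map (λ x → inj₁ (some-edge , x)) (bottom ∷ above)
    ; chain = match some-edge bottom ∷ Linkedₚ.map⁺ (Linked.map (lift some-edge) chain)
    ; length-above = cong suc (trans (length-map _ above) length-above)
    ; rank₁ = rank₁⁺
    ; rank₂ = rank₂⁺
    ; rank₁-injective = rank₁⁺-injective
    ; rank₂-injective = rank₂⁺-injective
    ; rank₁-mono = rank₁⁺-mono
    ; rank₂-mono = rank₂⁺-mono
    ; empty-rectangle = λ {x} → ◁-empty-rectangle {x}
    }

diagram : ∀ g m → ∃ λ n → Diagram (Fin n) g m
diagram g zero = 1 , point g
diagram g (suc m) with diagram g m
-- The argument `m` stands for `suc m` colours, the chromatic number of `D`.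
... | n , D with sparse-unavoidable g m (Diagram.R₁ D)
...   | H , H-girth , H-unavoidable = _ ,
  relabel (proj₂ ((H.E-finite ×-finite Fin-finite) ⊎-finite H.V-finite))
    (Descartes.descartes D H H-girth H-unavoidable)
  where module H = Hypergraph H

-- Cycles as closed nonbacktracking walks.

module _ {n : ℕ} {E : Graph (Fin n)} {g : ℕ} (girth : Girth≥ E g) where

  module _ {k : ℕ} (v : Fin (suc k) → Fin n) (2≤k : 2 ≤ k)
           (v-injective : ∀ {i j} → v i ≡ v j → i ≡ j) (edge : ∀ i → E (v i) (v (sucMod i))) where

    around : ℕ → Fin n
    around t = v (t mod suc k)

    toℕ-mod : ∀ {t} → t ≤ k → toℕ (t mod suc k) ≡ t
    toℕ-mod {t} t≤k = trans (Finₚ.toℕ-fromℕ< (m%n<n t (suc k))) (m<n⇒m%n≡m (s≤s t≤k))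

    around-edge : ∀ {t} → t ≤ k → E (around t) (around (suc t))
    around-edge {t} t≤k =
      subst (λ i → E (around t) (v (suc i mod suc k))) (toℕ-mod t≤k) (edge (t mod suc k))

    around-closed : around (suc k) ≡ around 0
    around-closed = cong v (Finₚ.toℕ-injective
      (trans (Finₚ.toℕ-fromℕ< (m%n<n (suc k) (suc k))) (n%n≡0 (suc k))))

    around-injective : ∀ {s t} → s ≤ k → t ≤ k → around s ≡ around t → s ≡ t
    around-injective s≤k t≤k eq =
      trans (sym (toℕ-mod s≤k)) (trans (cong toℕ (v-injective eq)) (toℕ-mod t≤k))

    -- Injectivity of `v` separates vertices two steps apart; the walk ends at position `suc k`,
    -- which is position `0`.
    unwind : ∀ d t → suc t + d ≡ k →
             Nonbacktracking E (around t) (around (suc t)) (around 0) (suc d)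
    unwind zero t eq = subst (λ x → Nonbacktracking E (around t) (around (suc t)) x 1) closed
      (step (around-edge (≤-reflexive t+1≡k)) (start≢ ∘ trans (sym closed)) stop)
      where
      t+1≡k : suc t ≡ k
      t+1≡k = trans (sym (+-identityʳ (suc t))) eq
      closed : around (suc (suc t)) ≡ around 0
      closed = subst (λ l → around (suc l) ≡ around 0) (sym t+1≡k) around-closed
      -- Here `suc t` is `k`, so `t` is positive because a cycle has at least three vertices.
      start≢ : around 0 ≢ around t
      start≢ e = <-irrefl (around-injective z≤n (subst (t ≤_) t+1≡k (n≤1+n t)) e)
                          (≤-pred (subst (2 ≤_) (sym t+1≡k) 2≤k))
    unwind (suc d) t eq = step (around-edge t+1≤k) next≢ (unwind d (suc t) eq′)
      where
      eq′ : suc (suc t) + d ≡ k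
      eq′ = trans (cong suc (sym (+-suc t d))) eq
      t+2≤k : suc (suc t) ≤ k
      t+2≤k = subst (suc (suc t) ≤_) eq′ (m≤m+n (suc (suc t)) d)
      t+1≤k : suc t ≤ k
      t+1≤k = <⇒≤ t+2≤k
      next≢ : around (suc (suc t)) ≢ around t
      next≢ e = <-irrefl (sym (around-injective t+2≤k (<⇒≤ t+1≤k) e)) (m<n⇒m<1+n ≤-refl)

    cycle-length : g ≤ suc k
    cycle-length = ≮⇒≥ (girth (around-edge z≤n) (closed 2≤k unwind))
      where
      closed : 2 ≤ k → (∀ d t → suc t + d ≡ k →
                         Nonbacktracking E (around t) (around (suc t)) (around 0) (suc d)) →
               Nonbacktracking E (around 0) (around 1) (around 0) k
      closed (s≤s {n = d} _) walk = walk d 0 refl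

  girth-at-least : GirthAtLeast E g
  girth-at-least (suc k) v (s≤s 2≤k , v-injective , edge) = cycle-length v 2≤k v-injective edge

-- The poset of a diagram.

rank-total : ∀ {n R} (rank : Fin n → Fin R) → (∀ {x y} → rank x ≡ rank y → x ≡ y) →
             IsStrictTotalOrder _≡_ (λ x y → rank x Fin.< rank y)
rank-total rank rank-injective = record
  { isStrictPartialOrder = record
    { isEquivalence = isEquivalence
    ; irrefl = λ { refl → <-irrefl refl }
    ; trans = <-trans
    ; <-resp-≈ = resp₂ _ }
  ; compare = compare }
  where
  compare : ∀ x y → _
  compare x y with Finₚ.<-cmp (rank x) (rank y)
  ... | tri< lt neq gt = tri< lt (neq ∘ cong rank) gt
  ... | tri≈ lt eq gt = tri≈ lt (rank-injective eq) gt
  ... | tri> lt neq gt = tri> lt (neq ∘ cong rank) gt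

module HassePoset {n g m : ℕ} (D : Diagram (Fin n) g m) where

  open Diagram D

  infix 4 _⊏_

  _⊏_ : Rel n
  _⊏_ = TransClosure _⋖_

  ⊏-mono : ∀ {R} (f : Fin n → Fin R) → (∀ {x y} → x ⋖ y → f x Fin.< f y) →
           ∀ {x y} → x ⊏ y → f x Fin.< f y
  ⊏-mono f mono [ a ] = mono a
  ⊏-mono f mono (a ∷ p) = <-trans (mono a) (⊏-mono f mono p)

  ⊏-poset : IsFinitePoset n _⊏_
  ⊏-poset = record
    { isEquivalence = isEquivalence
    ; irrefl = λ { refl p → <-irrefl refl (⊏-mono rank₁ rank₁-mono p) }
    ; trans = _++_
    ; <-resp-≈ = resp₂ _ }

  cover⇒edge : ∀ {x y} → Covers _⊏_ y x → x ⋖ y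
  cover⇒edge ([ a ] , _) = a
  cover⇒edge (a ∷ p , none) = ⊥-elim (none (_ , [ a ] , p))

  -- An intermediate element would lie in the rectangle of the edge, both ranks being monotone.
  edge⇒cover : ∀ {x y} → x ⋖ y → Covers _⊏_ y x
  edge⇒cover a = [ a ] , λ (z , p , q) →
    empty-rectangle a (⊏-mono rank₁ rank₁-mono p) (⊏-mono rank₁ rank₁-mono q)
                      (⊏-mono rank₂ rank₂-mono p) (⊏-mono rank₂ rank₂-mono q)

  adjacent⇒edge : ∀ {x y} → CoverAdj _⊏_ x y → SymClosure _⋖_ x y
  adjacent⇒edge (inj₁ c) = bwd (cover⇒edge c)
  adjacent⇒edge (inj₂ c) = fwd (cover⇒edge c)

  cover-girth : GirthAtLeast (CoverAdj _⊏_) g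
  cover-girth = girth-at-least
    (immersion-girth adjacent-sym (λ x → x) adjacent⇒edge (λ _ _ eq → eq) girth)
    where
    adjacent-sym : Symmetric (CoverAdj _⊏_)
    adjacent-sym (inj₁ c) = inj₂ c
    adjacent-sym (inj₂ c) = inj₁ c

  -- Colours increase along `⊏`, so the proper colouring also bounds the height.
  chain-bound : ∀ x xs → Linked _⊏_ (x ∷ xs) → toℕ (colour x) + length (x ∷ xs) ≤ suc m
  chain-bound x [] [-] = subst (_≤ suc m) (sym (+-comm (toℕ (colour x)) 1)) (Finₚ.toℕ<n (colour x))
  chain-bound x (y ∷ ys) (p ∷ c) = subst (_≤ suc m) (sym (+-suc (toℕ (colour x)) (length (y ∷ ys))))
    (≤-trans (+-monoˡ-≤ (length (y ∷ ys)) (⊏-mono colour colour-mono p)) (chain-bound y ys c))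

  height : HeightIs _⊏_ (suc m)
  height = (bottom ∷ above , Linked.map [_] chain , cong suc length-above) , bound
    where
    bound : ∀ c → IsChain _⊏_ c → length c ≤ suc m
    bound [] _ = z≤n
    bound (x ∷ xs) c = ≤-trans (m≤n+m _ (toℕ (colour x))) (chain-bound x xs c)

  chromatic : ChromaticIs (CoverAdj _⊏_) (suc m)
  chromatic = (colour , proper) , bound
    where
    proper : ProperColouring (CoverAdj _⊏_) (suc m) colour
    proper x y adj eq with adjacent⇒edge adj
    ... | fwd a = <-irrefl (cong toℕ eq) (colour-mono a)
    ... | bwd a = <-irrefl (cong toℕ (sym eq)) (colour-mono a)
    bound : ∀ k (c : Fin n → Fin k) → ProperColouring (CoverAdj _⊏_) k c → suc m ≤ k
    -- Fewer than `suc m` colours embed into `Fin m`.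
    bound k c c-proper = ≮⇒≥ λ { (s≤s k≤m) → uncolourable (λ x → inject≤ (c x) k≤m)
      λ {x} {y} a eq → c-proper x y (inj₂ (edge⇒cover a)) (Finₚ.inject≤-injective k≤m k≤m _ _ eq) }

  _<₁_ _<₂_ : Rel n
  x <₁ y = rank₁ x Fin.< rank₁ y
  x <₂ y = rank₂ x Fin.< rank₂ y

  extension₁ : IsLinearExtension _⊏_ _<₁_
  extension₁ = rank-total rank₁ rank₁-injective , λ _ _ → ⊏-mono rank₁ rank₁-mono

  extension₂ : IsLinearExtension _⊏_ _<₂_
  extension₂ = rank-total rank₂ rank₂-injective , λ _ _ → ⊏-mono rank₂ rank₂-mono

  between : ∀ {R} (rank : Fin n → Fin R) {x y z} → rank y Fin.< rank z →
            Between (λ x y → rank x Fin.< rank y) x y z → rank y Fin.< rank x × rank x Fin.< rank z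
  between rank _ (inj₁ b) = b
  between rank y<z (inj₂ (z<x , x<y)) = ⊥-elim (<-asym y<z (<-trans z<x x<y))

  -- Lying between in both orders would put `x` in the empty rectangle.
  eye-edge : ∀ x {y z} → y ⋖ z → ¬ Between _<₁_ x y z ⊎ ¬ Between _<₂_ x y z
  eye-edge x {y} {z} a with (rank₁ y Finₚ.<? rank₁ x) ×-dec (rank₁ x Finₚ.<? rank₁ z)
  ... | no ¬b = inj₁ (¬b ∘ between rank₁ (rank₁-mono a))
  ... | yes (p , q) = inj₂ λ b →
    let r , s = between rank₂ (rank₂-mono a) b in empty-rectangle a p q r s

  eye : EyeWitness₂ (CoverAdj _⊏_) _<₁_ _<₂_
  eye x y z _ _ _ adj with adjacent⇒edge adj
  ... | fwd a = eye-edge x a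
  ... | bwd a = Sum.map (_∘ swap) (_∘ swap) (eye-edge x a)

theorem2p7 : (g r : ℕ) → 1 ≤ g → 1 ≤ r →
    Σ ℕ λ n → Σ (Rel n) λ P →
    IsFinitePoset n P
    × HeightIs P r
    × GirthAtLeast (CoverAdj P) g
    × ChromaticIs (CoverAdj P) r
    × Σ (Rel n) λ L₁ → Σ (Rel n) λ L₂ →
    IsLinearExtension P L₁ × IsLinearExtension P L₂
    × EyeWitness₂ (CoverAdj P) L₁ L₂
theorem2p7 g (suc m) _ _ with diagram g m
... | n , D = n , _⊏_ , ⊏-poset , height , cover-girth , chromatic ,
              _<₁_ , _<₂_ , extension₁ , extension₂ , eye
  where open HassePoset D
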